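{- Let $(\mathcal{O},g,f)$ be a Euclidean oriented matroid program such that $(\mathcal{O},f,g)$ is an oriented matroid program. Then $(\mathcal{O},f,g)$ is Euclidean.
   Context: Oriented matroid $\mathcal{O}$ on $E$ of rank $r$; cocircuits are the minimal nonzero covectors; $z(X)=\{e:X_e=0\}$, $\mathrm{sep}(X,Y)=\{e:X_e=-Y_e\ne0\}$, conformal means $\mathrm{sep}=\emptyset$. Cocircuits $X\ne\pm Y$ are comodular if $z(X\circ Y)$ is a flat of rank $r-2$; elimination of $e\in\mathrm{sep}(X,Y)$ yields the unique cocircuit $Z$ with $Z_e=0$, $\mathrm{supp}(Z)\subseteq\mathrm{supp}(X\circ Y)\setminus\{e\}$. An oriented matroid program $(\mathcal{O},g,f)$: distinct $g,f\in E$, $g$ not a loop, $f$ not a coloop. For comodular $X,Y$ with $X_g=Y_g\ne0$ and $Z$ the elimination of $g$ between $-X$ and $Y$: $X\to Y$ if $Z_f=+$, $X\leftarrow Y$ if $Z_f=-$, undirected if $Z_f=0$. The graph $G_f$ has vertices the cocircuits with $g=+$, edges the conformal comodular pairs, directed so. The program is Euclidean if $G_f$ has no directed cycle (closed sequence of distinct vertices along edges, each forward or undirected, at least one forward). -}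

module Defs where

open import Data.Nat using (ℕ; zero; suc; _+_; _≤_)
import Data.Nat as ℕ
open import Data.Fin using (Fin; zero; suc; toℕ; lower₁)
open import Data.Fin.Subset using (Subset; _∈_; _∉_; _⊆_; ∣_∣; ⁅_⁆; _∪_; ⊤)
open import Data.Vec using (Vec; lookup; map; zipWith)
open import Data.Bool using (Bool; true; false)
open import Data.Product using (Σ; ∃; _×_; _,_)
open import Data.Sum using (_⊎_)
open import Data.Empty using (⊥)
open import Relation.Nullary using (¬_; yes; no)
open import Relation.Binary.PropositionalEquality using (_≡_; _≢_)

data Sign : Set where
  ⊖ 𝟘 ⊕ : Sign

-_ : Sign → Sign
- ⊖ = ⊕
- 𝟘 = 𝟘
- ⊕ = ⊖

SignVec : ℕ → Set
SignVec n = Vec Sign n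

module _ {n : ℕ} where

  0ᵥ : SignVec n
  0ᵥ = Data.Vec.replicate n 𝟘

  negᵥ : SignVec n → SignVec n
  negᵥ = map -_

  ∘ˢ : Sign → Sign → Sign
  ∘ˢ 𝟘 b = b
  ∘ˢ ⊖ _ = ⊖
  ∘ˢ ⊕ _ = ⊕

  _∘ᵥ_ : SignVec n → SignVec n → SignVec n
  _∘ᵥ_ = zipWith ∘ˢ

  isZero : Sign → Bool
  isZero 𝟘 = true
  isZero ⊖ = false
  isZero ⊕ = false

  z : SignVec n → Subset n
  z = map isZero

  SuppSub : SignVec n → SignVec n → Set
  SuppSub X Y = ∀ e → lookup X e ≢ 𝟘 → lookup Y e ≢ 𝟘

  InSep : Fin n → SignVec n → SignVec n → Set
  InSep e X Y = (lookup X e ≡ - lookup Y e) × (lookup X e ≢ 𝟘)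

  Conformal : SignVec n → SignVec n → Set
  Conformal X Y = ∀ e → ¬ InSep e X Y

  -- Z⁺ ⊆ X⁺ ∪ Y⁺ and Z⁻ ⊆ X⁻ ∪ Y⁻
  ElimSigns : SignVec n → SignVec n → SignVec n → Set
  ElimSigns X Y Z =
    ∀ a → (lookup Z a ≡ 𝟘) ⊎ ((lookup Z a ≡ lookup X a) ⊎ (lookup Z a ≡ lookup Y a))

record OrientedMatroid (n : ℕ) : Set₁ where
  field
    IsCocircuit : SignVec n → Set
    C0 : ¬ IsCocircuit 0ᵥ
    C1 : ∀ {X} → IsCocircuit X → IsCocircuit (negᵥ X)
    C2 : ∀ {X Y} → IsCocircuit X → IsCocircuit Y → SuppSub X Y →
         (X ≡ Y) ⊎ (X ≡ negᵥ Y)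
    C3 : ∀ {X Y} e → IsCocircuit X → IsCocircuit Y → X ≢ negᵥ Y → InSep e X Y →
         ∃ λ Z → IsCocircuit Z × (lookup Z e ≡ 𝟘) × ElimSigns X Y Z

module _ {n : ℕ} (O : OrientedMatroid n) where
  open OrientedMatroid O

  -- The underlying matroid (its cocircuits are the supports of the
  -- signed cocircuits).

  -- I is independent iff no e ∈ I lies in the closure of I - e, i.e.
  -- for every e ∈ I some cocircuit meets I exactly in e.
  Independent : Subset n → Set
  Independent I = ∀ e → e ∈ I →
    ∃ λ X → IsCocircuit X × (lookup X e ≢ 𝟘) ×
      (∀ a → a ∈ I → a ≢ e → lookup X a ≡ 𝟘)

  HasRank : Subset n → ℕ → Set
  HasRank A k =
    (∃ λ I → I ⊆ A × Independent I × ∣ I ∣ ≡ k) ×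
    (∀ I → I ⊆ A → Independent I → ∣ I ∣ ≤ k)

  IsFlat : Subset n → Set
  IsFlat A = ∀ e → e ∉ A →
    ∃ λ X → IsCocircuit X × (lookup X e ≢ 𝟘) × (∀ a → a ∈ A → lookup X a ≡ 𝟘)

  IsBasis : Subset n → Set
  IsBasis B = Independent B × (∀ e → e ∉ B → ¬ Independent (B ∪ ⁅ e ⁆))

  IsLoop : Fin n → Set
  IsLoop e = ¬ Independent ⁅ e ⁆

  IsColoop : Fin n → Set
  IsColoop e = ∀ B → IsBasis B → e ∈ B

  Comodular : SignVec n → SignVec n → Set
  Comodular X Y = IsCocircuit X × IsCocircuit Y × X ≢ Y × X ≢ negᵥ Y ×
    IsFlat (z (X ∘ᵥ Y)) ×
    (∃ λ k → HasRank (z (X ∘ᵥ Y)) k × HasRank ⊤ (k + 2))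

  IsElimination : Fin n → SignVec n → SignVec n → SignVec n → Set
  IsElimination e X Y Z = IsCocircuit Z × (lookup Z e ≡ 𝟘) × ElimSigns X Y Z

  IsProgram : Fin n → Fin n → Set
  IsProgram g f = (g ≢ f) × ¬ IsLoop g × ¬ IsColoop f

  module _ (g f : Fin n) where

    Vertex : SignVec n → Set
    Vertex X = IsCocircuit X × (lookup X g ≡ ⊕)

    Edge : SignVec n → SignVec n → Set
    Edge X Y = Conformal X Y × Comodular X Y

    Forward : SignVec n → SignVec n → Set
    Forward X Y = ∃ λ Z → IsElimination g (negᵥ X) Y Z × (lookup Z f ≡ ⊕)

    Undirected : SignVec n → SignVec n → Set
    Undirected X Y = ∃ λ Z → IsElimination g (negᵥ X) Y Z × (lookup Z f ≡ 𝟘)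

    Step : SignVec n → SignVec n → Set
    Step X Y = Edge X Y × (Forward X Y ⊎ Undirected X Y)

next : ∀ {k} → Fin (suc k) → Fin (suc k)
next {k} i with k ℕ.≟ toℕ i
... | yes _ = zero
... | no ne = suc (lower₁ i ne)

module _ {n : ℕ} (O : OrientedMatroid n) (g f : Fin n) where

  DirectedCycle : Set
  DirectedCycle = Σ ℕ λ k → Σ (Fin (suc k) → SignVec n) λ v →
    (∀ i j → v i ≡ v j → i ≡ j) ×
    (∀ i → Vertex O g f (v i)) ×
    (∀ i → Step O g f (v i) (v (next i))) ×
    (∃ λ i → Forward O g f (v i) (v (next i)))

  IsEuclidean : Set
  IsEuclidean = ¬ DirectedCycle

{-# OPTIONS --safe #-}

-- Along an edge X → Y of (O , f , g) the sign of the g-entry cannot decrease,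
-- so it is a constant s on a directed cycle. If s = 0, every elimination along
-- the cycle vanishes at g and no edge is forward. If s ≠ 0, the cocircuits s X
-- lie in the graph of (O , g , f). With Z and W the eliminations of f and of g
-- between - X and Y, the sign of W at f is - s Z_g: eliminating between Z and
-- - W an element where X vanishes returns ± X, the only cocircuits on the line
-- of X and Y vanishing there. Hence the reversed cycle is directed in
-- (O , g , f).

module Submission where

open import Defs
open import Data.Nat using (ℕ; suc; _≤_; z≤n; s≤s)
import Data.Nat as ℕ
import Data.Nat.Properties as ℕₚ
open import Data.Fin using (Fin; zero; suc; toℕ; fromℕ; inject₁; opposite)
open import Data.Fin.Properties using (toℕ-fromℕ; toℕ-inject₁-≢; lower₁-inject₁′; opposite-involutive; any?)
open import Data.Fin.Induction using (<-weakInduction; >-weakInduction)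
open import Data.Fin.Subset using (Subset; _∈_; _∉_; _⊆_; _⊃_; ∣_∣; ⁅_⁆; _∪_)
open import Data.Fin.Subset.Properties using (⊆-antisym; ∈⊤; x∈p∪q⁻; x∈p∪q⁺; x∈⁅x⁆; x∈⁅y⁆⇒x≡y; p⊂q⇒∣p∣<∣q∣)
open import Data.Fin.Subset.Induction using (⊃-wellFounded; Acc; acc)
open import Data.Vec using (lookup)
open import Data.Vec.Properties using (lookup-map; lookup-zipWith; lookup⇒[]=; []=⇒lookup; ≡-dec; map-id; map-cong; map-∘)
open import Data.Bool using (true)
open import Data.Product using (∃; _×_; _,_; proj₁; proj₂)
open import Data.Sum using (_⊎_; inj₁; inj₂; [_,_]′; swap)
import Data.Sum as Sum
open import Data.Empty using (⊥-elim)
open import Function using (_∘_)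
open import Relation.Nullary using (¬_; yes; no; ¬?; _×-dec_)
open import Relation.Binary.Definitions using (DecidableEquality)
open import Relation.Binary.PropositionalEquality using (_≡_; _≢_; refl; sym; trans; cong; subst; subst₂; module ≡-Reasoning)

-- Signs and sign vectors

_≟ˢ_ : DecidableEquality Sign
⊖ ≟ˢ ⊖ = yes refl
⊖ ≟ˢ 𝟘 = no λ ()
⊖ ≟ˢ ⊕ = no λ ()
𝟘 ≟ˢ ⊖ = no λ ()
𝟘 ≟ˢ 𝟘 = yes refl
𝟘 ≟ˢ ⊕ = no λ ()
⊕ ≟ˢ ⊖ = no λ ()
⊕ ≟ˢ 𝟘 = no λ ()
⊕ ≟ˢ ⊕ = yes refl

-‿involutive : ∀ s → - (- s) ≡ s
-‿involutive ⊖ = refl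
-‿involutive 𝟘 = refl
-‿involutive ⊕ = refl

-s≡𝟘⇒s≡𝟘 : ∀ s → - s ≡ 𝟘 → s ≡ 𝟘
-s≡𝟘⇒s≡𝟘 𝟘 _ = refl

≡⇒≢𝟘 : ∀ {s t} → t ≢ 𝟘 → s ≡ t → s ≢ 𝟘
≡⇒≢𝟘 t≢𝟘 refl = t≢𝟘

≢𝟘⇒≡⊎≡- : ∀ s t → s ≢ 𝟘 → t ≢ 𝟘 → s ≡ t ⊎ s ≡ - t
≢𝟘⇒≡⊎≡- 𝟘 _ s≢𝟘 _ = ⊥-elim (s≢𝟘 refl)
≢𝟘⇒≡⊎≡- _ 𝟘 _ t≢𝟘 = ⊥-elim (t≢𝟘 refl)
≢𝟘⇒≡⊎≡- ⊖ ⊖ _ _ = inj₁ refl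
≢𝟘⇒≡⊎≡- ⊖ ⊕ _ _ = inj₂ refl
≢𝟘⇒≡⊎≡- ⊕ ⊖ _ _ = inj₂ refl
≢𝟘⇒≡⊎≡- ⊕ ⊕ _ _ = inj₁ refl

infixl 7 _·_

_·_ : Sign → Sign → Sign
⊖ · t = - t
𝟘 · t = 𝟘
⊕ · t = t

-- Encodes the order ⊖ < 𝟘 < ⊕, so that an argument about monotone natural numbers around a cycle
-- applies to signs.
level : Sign → ℕ
level ⊖ = 0
level 𝟘 = 1
level ⊕ = 2

level-injective : ∀ {s t} → level s ≡ level t → s ≡ t
level-injective {⊖} {⊖} _ = refl
level-injective {𝟘} {𝟘} _ = refl
level-injective {⊕} {⊕} _ = refl

module _ {n : ℕ} where

  _≟ᵥ_ : DecidableEquality (SignVec n)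
  _≟ᵥ_ = ≡-dec _≟ˢ_

  lookup-neg : ∀ (X : SignVec n) e → lookup (negᵥ X) e ≡ - lookup X e
  lookup-neg X e = lookup-map e -_ X

  negᵥ-involutive : ∀ (X : SignVec n) → negᵥ (negᵥ X) ≡ X
  negᵥ-involutive X =
    trans (sym (map-∘ -_ -_ X)) (trans (map-cong -‿involutive X) (map-id X))

  negᵥ-injective : ∀ {X Y : SignVec n} → negᵥ X ≡ negᵥ Y → X ≡ Y
  negᵥ-injective {X} {Y} eq =
    trans (sym (negᵥ-involutive X)) (trans (cong negᵥ eq) (negᵥ-involutive Y))

  negᵥ-flip : ∀ {X Y : SignVec n} → X ≡ negᵥ Y → Y ≡ negᵥ X
  negᵥ-flip {Y = Y} refl = sym (negᵥ-involutive Y)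

  neg-zero⁺ : ∀ (X : SignVec n) e → lookup X e ≡ 𝟘 → lookup (negᵥ X) e ≡ 𝟘
  neg-zero⁺ X e X≡𝟘 = trans (lookup-neg X e) (cong -_ X≡𝟘)

  neg-zero⁻ : ∀ (X : SignVec n) e → lookup (negᵥ X) e ≡ 𝟘 → lookup X e ≡ 𝟘
  neg-zero⁻ X e -X≡𝟘 = -s≡𝟘⇒s≡𝟘 _ (trans (sym (lookup-neg X e)) -X≡𝟘)

  ±-zero : ∀ {X Y : SignVec n} → X ≡ Y ⊎ X ≡ negᵥ Y →
           ∀ e → lookup X e ≡ 𝟘 → lookup Y e ≡ 𝟘
  ±-zero (inj₁ refl) e X≡𝟘 = X≡𝟘
  ±-zero {Y = Y} (inj₂ refl) e X≡𝟘 = neg-zero⁻ Y e X≡𝟘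

  -- For comodular cocircuits `X` and `Y` and a cocircuit `Z`, this says that `Z` lies on the line
  -- through `X` and `Y`: it vanishes on the flat `z (X ∘ᵥ Y)`.
  Spanned : SignVec n → SignVec n → SignVec n → Set
  Spanned X Y Z = ∀ e → lookup X e ≡ 𝟘 → lookup Y e ≡ 𝟘 → lookup Z e ≡ 𝟘

  ElimSigns⇒Spanned : ∀ (X Y Z : SignVec n) → ElimSigns X Y Z → Spanned X Y Z
  ElimSigns⇒Spanned X Y Z signs e X≡𝟘 Y≡𝟘 with signs e
  ... | inj₁ Z≡𝟘 = Z≡𝟘
  ... | inj₂ (inj₁ Z≡X) = trans Z≡X X≡𝟘
  ... | inj₂ (inj₂ Z≡Y) = trans Z≡Y Y≡𝟘

  ∈z∘⁻ : ∀ (X Y : SignVec n) {e} → e ∈ z (X ∘ᵥ Y) →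
         lookup X e ≡ 𝟘 × lookup Y e ≡ 𝟘
  ∈z∘⁻ X Y {e} e∈z = zero-∘ˢ (lookup X e) (lookup Y e)
    (subst (λ s → isZero {n} s ≡ true) (lookup-zipWith (∘ˢ {n}) e X Y)
      (trans (sym (lookup-map e (isZero {n}) (X ∘ᵥ Y))) ([]=⇒lookup e∈z)))
    where
    zero-∘ˢ : ∀ s t → isZero {n} (∘ˢ {n} s t) ≡ true → s ≡ 𝟘 × t ≡ 𝟘
    zero-∘ˢ 𝟘 𝟘 _ = refl , refl

  ∈z∘⁺ : ∀ (X Y : SignVec n) {e} → lookup X e ≡ 𝟘 → lookup Y e ≡ 𝟘 →
         e ∈ z (X ∘ᵥ Y)
  ∈z∘⁺ X Y {e} X≡𝟘 Y≡𝟘 = lookup⇒[]= e _ (begin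
    lookup (z (X ∘ᵥ Y)) e                 ≡⟨ lookup-map e (isZero {n}) (X ∘ᵥ Y) ⟩
    isZero {n} (lookup (X ∘ᵥ Y) e)        ≡⟨ cong (isZero {n}) (lookup-zipWith (∘ˢ {n}) e X Y) ⟩
    isZero {n} (∘ˢ {n} (lookup X e) (lookup Y e))
      ≡⟨ cong (λ s → isZero {n} (∘ˢ {n} s (lookup Y e))) X≡𝟘 ⟩
    isZero {n} (lookup Y e)               ≡⟨ cong (isZero {n}) Y≡𝟘 ⟩
    true                                  ∎)
    where open ≡-Reasoning

  z∘-comm : ∀ (X Y : SignVec n) → z (X ∘ᵥ Y) ≡ z (Y ∘ᵥ X)
  z∘-comm X Y = ⊆-antisym (swap-⊆ X Y) (swap-⊆ Y X)
    where
    swap-⊆ : ∀ X Y → z (X ∘ᵥ Y) ⊆ z (Y ∘ᵥ X)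
    swap-⊆ X Y e∈z with ∈z∘⁻ X Y e∈z
    ... | X≡𝟘 , Y≡𝟘 = ∈z∘⁺ Y X Y≡𝟘 X≡𝟘

  z∘-neg : ∀ (X Y : SignVec n) → z (X ∘ᵥ Y) ≡ z (negᵥ X ∘ᵥ negᵥ Y)
  z∘-neg X Y = ⊆-antisym to from
    where
    to : z (X ∘ᵥ Y) ⊆ z (negᵥ X ∘ᵥ negᵥ Y)
    to {e} e∈z with ∈z∘⁻ X Y e∈z
    ... | X≡𝟘 , Y≡𝟘 = ∈z∘⁺ (negᵥ X) (negᵥ Y) (neg-zero⁺ X e X≡𝟘) (neg-zero⁺ Y e Y≡𝟘)
    from : z (negᵥ X ∘ᵥ negᵥ Y) ⊆ z (X ∘ᵥ Y)
    from {e} e∈z with ∈z∘⁻ (negᵥ X) (negᵥ Y) e∈z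
    ... | X≡𝟘 , Y≡𝟘 = ∈z∘⁺ X Y (neg-zero⁻ X e X≡𝟘) (neg-zero⁻ Y e Y≡𝟘)

  Conformal-sym : ∀ (X Y : SignVec n) → Conformal X Y → Conformal Y X
  Conformal-sym X Y conf e (Y≡-X , Y≢𝟘) =
    conf e (X≡-Y , λ X≡𝟘 → Y≢𝟘 (trans Y≡-X (cong -_ X≡𝟘)))
    where
    X≡-Y : lookup X e ≡ - lookup Y e
    X≡-Y = trans (sym (-‿involutive _)) (cong -_ (sym Y≡-X))

  Conformal-neg : ∀ (X Y : SignVec n) → Conformal X Y → Conformal (negᵥ X) (negᵥ Y)
  Conformal-neg X Y conf e (-X≡--Y , -X≢𝟘) =
    conf e (X≡-Y , λ X≡𝟘 → -X≢𝟘 (neg-zero⁺ X e X≡𝟘))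
    where
    open ≡-Reasoning
    X≡-Y : lookup X e ≡ - lookup Y e
    X≡-Y = begin
      lookup X e              ≡⟨ -‿involutive _ ⟨
      - (- lookup X e)        ≡⟨ cong -_ (lookup-neg X e) ⟨
      - lookup (negᵥ X) e     ≡⟨ cong -_ -X≡--Y ⟩
      - (- lookup (negᵥ Y) e) ≡⟨ -‿involutive _ ⟩
      lookup (negᵥ Y) e       ≡⟨ lookup-neg Y e ⟩
      - lookup Y e            ∎

-- Elimination and independence

module _ {n : ℕ} (O : OrientedMatroid n) where
  open OrientedMatroid O

  -- The contrapositive of `C2`; a search over the finite ground set produces the witness
  -- constructively.
  support-difference : ∀ {X Y} → IsCocircuit X → IsCocircuit Y →
                       X ≢ Y → X ≢ negᵥ Y → ∃ λ e → lookup X e ≢ 𝟘 × lookup Y e ≡ 𝟘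
  support-difference {X} {Y} Xc Yc X≢Y X≢-Y
    with any? (λ e → ¬? (lookup X e ≟ˢ 𝟘) ×-dec (lookup Y e ≟ˢ 𝟘))
  ... | yes found = found
  ... | no none = ⊥-elim ([ X≢Y , X≢-Y ]′
          (C2 Xc Yc λ e X≢𝟘 Y≡𝟘 → none (e , X≢𝟘 , Y≡𝟘)))

  -- This is elimination in the underlying matroid, where signs do not matter: if `X` and `Y` agree
  -- at `e`, then `C3` is applied to `X` and `negᵥ Y`, which has the same zeros as `Y`.
  weak-elimination : ∀ {X Y} e → IsCocircuit X → IsCocircuit Y →
    X ≢ Y → X ≢ negᵥ Y → lookup X e ≢ 𝟘 → lookup Y e ≢ 𝟘 →
    ∃ λ Z → IsCocircuit Z × lookup Z e ≡ 𝟘 × Spanned X Y Z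
  weak-elimination {X} {Y} e Xc Yc X≢Y X≢-Y Xe≢𝟘 Ye≢𝟘
    with ≢𝟘⇒≡⊎≡- (lookup X e) (lookup Y e) Xe≢𝟘 Ye≢𝟘
  ... | inj₂ Xe≡-Ye with C3 e Xc Yc X≢-Y (Xe≡-Ye , Xe≢𝟘)
  ...   | Z , Zc , Ze , signs = Z , Zc , Ze , ElimSigns⇒Spanned X Y Z signs
  weak-elimination {X} {Y} e Xc Yc X≢Y X≢-Y Xe≢𝟘 Ye≢𝟘
      | inj₁ Xe≡Ye with C3 e Xc (C1 Yc) (λ X≡--Y → X≢Y (trans X≡--Y (negᵥ-involutive Y)))
                        (trans Xe≡Ye (trans (sym (-‿involutive _)) (cong -_ (sym (lookup-neg Y e)))) , Xe≢𝟘)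
  ...   | Z , Zc , Ze , signs =
          Z , Zc , Ze , λ b Xb Yb → ElimSigns⇒Spanned X (negᵥ Y) Z signs b Xb (neg-zero⁺ Y b Yb)

  -- If U from weak elimination misses a, pick b in U outside X; eliminating b
  -- between Y and U keeps e and gives V, and (X , V) has smaller joint support.
  strong-elimination : ∀ {X Y} e a → IsCocircuit X → IsCocircuit Y →
    lookup X e ≢ 𝟘 → lookup Y e ≢ 𝟘 → lookup X a ≢ 𝟘 → lookup Y a ≡ 𝟘 →
    ∃ λ Z → IsCocircuit Z × lookup Z e ≡ 𝟘 × lookup Z a ≢ 𝟘 × Spanned X Y Z
  -- The recursion is on the common zero set, which grows strictly as the joint support shrinks.
  strong-elimination {X₀} {Y₀} = go (⊃-wellFounded (z (X₀ ∘ᵥ Y₀)))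
    where
    go : ∀ {X Y} → Acc _⊃_ (z (X ∘ᵥ Y)) → ∀ e a → IsCocircuit X → IsCocircuit Y →
      lookup X e ≢ 𝟘 → lookup Y e ≢ 𝟘 → lookup X a ≢ 𝟘 → lookup Y a ≡ 𝟘 →
      ∃ λ Z → IsCocircuit Z × lookup Z e ≡ 𝟘 × lookup Z a ≢ 𝟘 × Spanned X Y Z
    go {X} {Y} (acc rec) e a Xc Yc Xe Ye Xa Ya
      with weak-elimination e Xc Yc
             (λ { refl → Xa Ya }) (λ { refl → Xa (neg-zero⁺ Y a Ya) }) Xe Ye
    ... | U , Uc , Ue , UXY with lookup U a ≟ˢ 𝟘
    ...   | no Ua = U , Uc , Ue , Ua , UXY
    ...   | yes Ua
      with support-difference Uc Xc
             (λ { refl → Xa Ua }) (λ { refl → Xa (neg-zero⁻ X a Ua) })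
    ...     | b , Ub , Xb
      -- The pair `Y`, `U` is smaller too, since both vanish at `a` and `X` does not. The entry of
      -- `Y` at `b` is nonzero, because `U` would otherwise vanish there together with `X` and `Y`.
      with go (rec (XY⊆YU , a , ∈z∘⁺ Y U Ya Ua , Xa ∘ proj₁ ∘ ∈z∘⁻ X Y)) b e Yc Uc
             (λ Yb → Ub (UXY b Xb Yb)) Ub Ye Ue
      where
      XY⊆YU : z (X ∘ᵥ Y) ⊆ z (Y ∘ᵥ U)
      XY⊆YU {c} c∈z with ∈z∘⁻ X Y c∈z
      ... | Xc≡𝟘 , Yc≡𝟘 = ∈z∘⁺ Y U Yc≡𝟘 (UXY c Xc≡𝟘 Yc≡𝟘)
    ...       | V , Vc , Vb , Ve , VYU
      with go (rec (XY⊆XV , b , ∈z∘⁺ X V Xb Vb , λ b∈z → Ub (UXY b Xb (proj₂ (∈z∘⁻ X Y b∈z)))))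
             e a Xc Vc Xe Ve Xa (VYU a Ya Ua)
      where
      XY⊆XV : z (X ∘ᵥ Y) ⊆ z (X ∘ᵥ V)
      XY⊆XV {c} c∈z with ∈z∘⁻ X Y c∈z
      ... | Xc≡𝟘 , Yc≡𝟘 = ∈z∘⁺ X V Xc≡𝟘 (VYU c Yc≡𝟘 (UXY c Xc≡𝟘 Yc≡𝟘))
    ...         | Z , Zc , Ze , Za , ZXV =
                  Z , Zc , Ze , Za , λ c Xc≡𝟘 Yc≡𝟘 →
                    ZXV c Xc≡𝟘 (VYU c Yc≡𝟘 (UXY c Xc≡𝟘 Yc≡𝟘))

  -- `D` itself certifies `e`. The old certificate `T` of `a` in `I` may be nonzero at `e`; strong
  -- elimination of `e` between `T` and `D` repairs this and keeps `a`, where `D` vanishes.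
  independent-extension : ∀ {I D} e → Independent O I → IsCocircuit D →
    lookup D e ≢ 𝟘 → (∀ a → a ∈ I → lookup D a ≡ 𝟘) → Independent O (I ∪ ⁅ e ⁆)
  independent-extension {I} {D} e ind Dc De DI a a∈ with x∈p∪q⁻ I ⁅ e ⁆ a∈
  ... | inj₂ a∈e with refl ← x∈⁅y⁆⇒x≡y e a∈e = D , Dc , De , others
    where
    others : ∀ b → b ∈ I ∪ ⁅ e ⁆ → b ≢ e → lookup D b ≡ 𝟘
    others b b∈ b≢e = [ DI b , (λ b∈e → ⊥-elim (b≢e (x∈⁅y⁆⇒x≡y e b∈e))) ]′ (x∈p∪q⁻ I ⁅ e ⁆ b∈)
  ... | inj₁ a∈I with ind a a∈I
  ...   | T , Tc , Ta , TI with lookup T e ≟ˢ 𝟘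
  ...     | yes Te = T , Tc , Ta , others
    where
    others : ∀ b → b ∈ I ∪ ⁅ e ⁆ → b ≢ a → lookup T b ≡ 𝟘
    others b b∈ b≢a with x∈p∪q⁻ I ⁅ e ⁆ b∈
    ... | inj₁ b∈I = TI b b∈I b≢a
    ... | inj₂ b∈e with refl ← x∈⁅y⁆⇒x≡y e b∈e = Te
  ...     | no Te with strong-elimination e a Tc Dc Te De Ta (DI a a∈I)
  ...       | S , Sc , Se , Sa , STD = S , Sc , Sa , others
    where
    others : ∀ b → b ∈ I ∪ ⁅ e ⁆ → b ≢ a → lookup S b ≡ 𝟘
    others b b∈ b≢a with x∈p∪q⁻ I ⁅ e ⁆ b∈
    ... | inj₁ b∈I = STD b (TI b b∈I b≢a) (DI b b∈I)
    ... | inj₂ b∈e with refl ← x∈⁅y⁆⇒x≡y e b∈e = Se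

  ∣∪⁅⁆∣ : ∀ {I : Subset n} {e} → e ∉ I → ∣ I ∣ ℕ.< ∣ I ∪ ⁅ e ⁆ ∣
  ∣∪⁅⁆∣ {I} {e} e∉I = p⊂q⇒∣p∣<∣q∣
    (x∈p∪q⁺ ∘ inj₁ , e , x∈p∪q⁺ (inj₂ (x∈⁅x⁆ e)) , e∉I)

  zero-on-extension : ∀ {I : Subset n} X e → (∀ a → a ∈ I → lookup X a ≡ 𝟘) →
                      lookup X e ≡ 𝟘 → ∀ a → a ∈ I ∪ ⁅ e ⁆ → lookup X a ≡ 𝟘
  zero-on-extension {I} X e XI Xe a a∈ with x∈p∪q⁻ I ⁅ e ⁆ a∈
  ... | inj₁ a∈I = XI a a∈I
  ... | inj₂ a∈e with refl ← x∈⁅y⁆⇒x≡y e a∈e = Xe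

  -- Otherwise a basis of z (X ∘ Y), the element e and the two support
  -- differences of A and B would be independent of size r + 1.
  line-unique : ∀ {X Y A B} → Comodular O X Y → IsCocircuit A → IsCocircuit B →
    Spanned X Y A → Spanned X Y B →
    ∀ e → ¬ (lookup X e ≡ 𝟘 × lookup Y e ≡ 𝟘) → lookup A e ≡ 𝟘 → lookup B e ≡ 𝟘 →
    A ≡ B ⊎ A ≡ negᵥ B
  line-unique {X} {Y} {A} {B}
    (_ , _ , _ , _ , flat , k , ((I , I⊆F , ind , ∣I∣≡k) , _) , (_ , bound))
    Ac Bc AXY BXY e e∉ Ae Be with A ≟ᵥ B | A ≟ᵥ negᵥ B
  ... | yes A≡B | _ = inj₁ A≡B
  ... | no _ | yes A≡-B = inj₂ A≡-B
  ... | no A≢B | no A≢-B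
    with flat e (e∉ ∘ ∈z∘⁻ X Y)
       | support-difference Ac Bc A≢B A≢-B
       | support-difference Bc Ac (A≢B ∘ sym) (A≢-B ∘ negᵥ-flip)
  ... | D , Dc , De , DF | p , Ap , Bp | q , Bq , Aq =
    ⊥-elim (ℕₚ.<⇒≱ too-large (bound I₃ (λ _ → ∈⊤) ind₃))
    where
    I₁ I₂ I₃ : Subset n
    I₁ = I ∪ ⁅ e ⁆
    I₂ = I₁ ∪ ⁅ p ⁆
    I₃ = I₂ ∪ ⁅ q ⁆

    DI : ∀ a → a ∈ I → lookup D a ≡ 𝟘
    DI a a∈I = DF a (I⊆F a∈I)

    spanned-zero : ∀ C → Spanned X Y C → ∀ a → a ∈ I → lookup C a ≡ 𝟘
    spanned-zero C CXY a a∈I with ∈z∘⁻ X Y (I⊆F a∈I)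
    ... | Xa , Ya = CXY a Xa Ya

    AI₁ : ∀ a → a ∈ I₁ → lookup A a ≡ 𝟘
    AI₁ = zero-on-extension A e (spanned-zero A AXY) Ae

    BI₂ : ∀ a → a ∈ I₂ → lookup B a ≡ 𝟘
    BI₂ = zero-on-extension B p (zero-on-extension B e (spanned-zero B BXY) Be) Bp

    ind₃ : Independent O I₃
    -- Each added element has a cocircuit that is nonzero there and zero on the set built so far:
    -- `D` for `e`, `A` for `p` and `B` for `q`.
    ind₃ = independent-extension q
             (independent-extension p (independent-extension e ind Dc De DI) Ac Ap AI₁)
             Bc Bq BI₂

    too-large : k ℕ.+ 2 ℕ.< ∣ I₃ ∣
    too-large = begin-strict
      k ℕ.+ 2               ≡⟨ ℕₚ.+-comm k 2 ⟩
      suc (suc k)           ≡⟨ cong (2 ℕ.+_) ∣I∣≡k ⟨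
      suc (suc ∣ I ∣)       ≤⟨ s≤s (∣∪⁅⁆∣ (De ∘ DI e)) ⟩
      suc ∣ I₁ ∣            ≤⟨ ∣∪⁅⁆∣ (Ap ∘ AI₁ p) ⟩
      ∣ I₂ ∣                <⟨ ∣∪⁅⁆∣ (Bq ∘ BI₂ q) ⟩
      ∣ I₃ ∣                ∎
      where open ℕₚ.≤-Reasoning

-- Edges and their eliminations

  Comodular-sym : ∀ {X Y} → Comodular O X Y → Comodular O Y X
  Comodular-sym {X} {Y} (Xc , Yc , X≢Y , X≢-Y , flat , k , rankF , rank⊤) =
    Yc , Xc , X≢Y ∘ sym , X≢-Y ∘ negᵥ-flip ,
    subst (IsFlat O) (z∘-comm X Y) flat ,
    k , subst (λ F → HasRank O F k) (z∘-comm X Y) rankF , rank⊤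

  Comodular-neg : ∀ {X Y} → Comodular O X Y → Comodular O (negᵥ X) (negᵥ Y)
  Comodular-neg {X} {Y} (Xc , Yc , X≢Y , X≢-Y , flat , k , rankF , rank⊤) =
    C1 Xc , C1 Yc , X≢Y ∘ negᵥ-injective , X≢-Y ∘ negᵥ-injective ,
    subst (IsFlat O) (z∘-neg X Y) flat ,
    k , subst (λ F → HasRank O F k) (z∘-neg X Y) rankF , rank⊤

  IsElimination-sym : ∀ {e} X Y {Z} → IsElimination O e X Y Z → IsElimination O e Y X Z
  IsElimination-sym X Y (Zc , Ze , signs) = Zc , Ze , λ a → Sum.map₂ swap (signs a)

  IsElimination-neg : ∀ {e} X Y {Z} → IsElimination O e X Y Z →
                      IsElimination O e (negᵥ X) (negᵥ Y) (negᵥ Z)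
  IsElimination-neg {e} X Y {Z} (Zc , Ze , signs) =
    C1 Zc , neg-zero⁺ Z e Ze ,
    λ a → Sum.map (neg-zero⁺ Z a) (Sum.map (neg-≡ X a) (neg-≡ Y a)) (signs a)
    where
    neg-≡ : ∀ V a → lookup Z a ≡ lookup V a → lookup (negᵥ Z) a ≡ lookup (negᵥ V) a
    neg-≡ V a eq = trans (lookup-neg Z a) (trans (cong -_ eq) (sym (lookup-neg V a)))

  IsElimination⇒Spanned : ∀ {e} X Y {Z} → IsElimination O e (negᵥ X) Y Z → Spanned X Y Z
  IsElimination⇒Spanned X Y {Z} (_ , _ , signs) a Xa Ya =
    ElimSigns⇒Spanned (negᵥ X) Y Z signs a (neg-zero⁺ X a Xa) Ya

  -- Carries the direction of an edge between the two programs: `Z` decides it in the program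
  -- `(O , f , g)`, and `W` decides it in `(O , g , f)` up to orientation.
  elimination-swap : ∀ {X Y Z W f g s} → Comodular O X Y → s ≢ 𝟘 →
    lookup X f ≡ ⊕ → lookup X g ≡ s →
    IsElimination O f (negᵥ X) Y Z → IsElimination O g (negᵥ X) Y W →
    lookup W f ≡ - (s · lookup Z g)
  elimination-swap {X} {Y} {Z} {W} {f} {g} {s}
    cm@(Xc , Yc , X≢Y , X≢-Y , _) s≢𝟘 Xf Xg
    Zel@(Zc , Zf , Zsigns) Wel@(Wc , Wg , Wsigns) with Z ≟ᵥ W
  -- If `Z` and `W` coincide, this cocircuit vanishes at both `f` and `g`, so both sides are 𝟘.
  -- Otherwise `Z` is not the negative of `negᵥ W`, as `C3` requires.
  ... | yes refl = trans Zf (sym (trans (cong (λ t → - (s · t)) Wg) (-[s·𝟘] s)))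
    where
    -[s·𝟘] : ∀ s → - (s · 𝟘) ≡ 𝟘
    -[s·𝟘] ⊖ = refl
    -[s·𝟘] 𝟘 = refl
    -[s·𝟘] ⊕ = refl
  ... | no Z≢W
    with support-difference Yc Xc (X≢Y ∘ sym) (X≢-Y ∘ negᵥ-flip)
  -- Vanishing at `x` singles out `X` and its negative among the cocircuits of the line.
  ... | x , Yx , Xx = conclude
    where
    x∉ : ¬ (lookup X x ≡ 𝟘 × lookup Y x ≡ 𝟘)
    x∉ = Yx ∘ proj₂

    ZXY : Spanned X Y Z
    ZXY = IsElimination⇒Spanned X Y Zel

    WXY : Spanned X Y W
    WXY = IsElimination⇒Spanned X Y Wel

    -- V vanishing at x would be ± X, which is nonzero at c.
    at-x : ∀ {V c} → IsElimination O c (negᵥ X) Y V → lookup X c ≢ 𝟘 →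
           lookup V x ≡ lookup Y x
    at-x {V} {c} Vel@(Vc , Vc≡𝟘 , Vsigns) Xc≢𝟘 with Vsigns x
    ... | inj₂ (inj₂ Vx≡Yx) = Vx≡Yx
    ... | inj₁ Vx≡𝟘 = ⊥-elim (Xc≢𝟘 (±-zero
          (line-unique cm Vc Xc (IsElimination⇒Spanned X Y Vel) (λ _ Xa _ → Xa) x x∉ Vx≡𝟘 Xx) c Vc≡𝟘))
    ... | inj₂ (inj₁ Vx≡-Xx) = ⊥-elim (Xc≢𝟘 (±-zero
          (line-unique cm Vc Xc (IsElimination⇒Spanned X Y Vel) (λ _ Xa _ → Xa) x x∉
            (trans Vx≡-Xx (neg-zero⁺ X x Xx)) Xx) c Vc≡𝟘))

    Xf≢𝟘 : lookup X f ≢ 𝟘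
    Xf≢𝟘 = ≡⇒≢𝟘 (λ ()) Xf

    Xg≢𝟘 : lookup X g ≢ 𝟘
    Xg≢𝟘 = ≡⇒≢𝟘 s≢𝟘 Xg

    Zx≡Yx : lookup Z x ≡ lookup Y x
    Zx≡Yx = at-x Zel Xf≢𝟘

    x∈sep : InSep x Z (negᵥ W)
    x∈sep = (begin
      lookup Z x            ≡⟨ Zx≡Yx ⟩
      lookup Y x            ≡⟨ at-x Wel Xg≢𝟘 ⟨
      lookup W x            ≡⟨ -‿involutive _ ⟨
      - (- lookup W x)      ≡⟨ cong -_ (lookup-neg W x) ⟨
      - lookup (negᵥ W) x   ∎) , λ Zx → Yx (trans (sym Zx≡Yx) Zx)
      where open ≡-Reasoning

    -- A nonzero sign squares to ⊕, so multiplying the equation by `s` isolates `w`.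
    solve : ∀ s t w → s ≢ 𝟘 → t ≡ s · (- w) → w ≡ - (s · t)
    solve ⊖ _ w _ refl = sym (trans (-‿involutive _) (-‿involutive w))
    solve 𝟘 _ _ s≢𝟘 _ = ⊥-elim (s≢𝟘 refl)
    solve ⊕ _ w _ refl = sym (-‿involutive w)

    g-entry : ∀ {U} → U ≡ X ⊎ U ≡ negᵥ X → lookup U g ≡ s · lookup U f
    g-entry (inj₁ refl) = trans Xg (trans (sym (s·⊕ s)) (cong (s ·_) (sym Xf)))
      where
      s·⊕ : ∀ s → s · ⊕ ≡ s
      s·⊕ ⊖ = refl
      s·⊕ 𝟘 = refl
      s·⊕ ⊕ = refl
    g-entry (inj₂ refl) = begin
      lookup (negᵥ X) g      ≡⟨ lookup-neg X g ⟩
      - lookup X g           ≡⟨ cong -_ Xg ⟩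
      - s                    ≡⟨ s·⊖ s ⟨
      s · ⊖                  ≡⟨ cong (λ t → s · (- t)) Xf ⟨
      s · (- lookup X f)     ≡⟨ cong (s ·_) (lookup-neg X f) ⟨
      s · lookup (negᵥ X) f  ∎
      where
      open ≡-Reasoning
      s·⊖ : ∀ s → s · ⊖ ≡ - s
      s·⊖ ⊖ = refl
      s·⊖ 𝟘 = refl
      s·⊖ ⊕ = refl

    conclude : lookup W f ≡ - (s · lookup Z g)
    -- `U` vanishes at `x`, hence is `X` or its negative and is nonzero at `f` and `g`. Since `Z`
    -- vanishes at `f` and `W` at `g`, `U` takes its entry at `f` from `negᵥ W` and its entry at `g`
    -- from `Z`; `g-entry` relates the two.
    conclude with C3 x Zc (C1 Wc) (λ Z≡--W → Z≢W (trans Z≡--W (negᵥ-involutive W))) x∈sep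
    ... | U , Uc , Ux , Usigns =
      solve s (lookup Z g) (lookup W f) s≢𝟘 (trans (sym Ug≡Zg) (trans (g-entry U≡±X) (cong (s ·_) Uf≡-Wf)))
      where
      UXY : Spanned X Y U
      UXY a Xa Ya = ElimSigns⇒Spanned Z (negᵥ W) U Usigns a (ZXY a Xa Ya) (neg-zero⁺ W a (WXY a Xa Ya))

      U≡±X : U ≡ X ⊎ U ≡ negᵥ X
      U≡±X = line-unique cm Uc Xc UXY (λ _ Xa _ → Xa) x x∉ Ux Xx

      Uf≡-Wf : lookup U f ≡ - lookup W f
      Uf≡-Wf with Usigns f
      ... | inj₁ Uf≡𝟘 = ⊥-elim (Xf≢𝟘 (±-zero U≡±X f Uf≡𝟘))
      ... | inj₂ (inj₁ Uf≡Zf) = ⊥-elim (Xf≢𝟘 (±-zero U≡±X f (trans Uf≡Zf Zf)))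
      ... | inj₂ (inj₂ Uf≡-Wf′) = trans Uf≡-Wf′ (lookup-neg W f)

      Ug≡Zg : lookup U g ≡ lookup Z g
      Ug≡Zg with Usigns g
      ... | inj₁ Ug≡𝟘 = ⊥-elim (Xg≢𝟘 (±-zero U≡±X g Ug≡𝟘))
      ... | inj₂ (inj₁ Ug≡Zg′) = Ug≡Zg′
      ... | inj₂ (inj₂ Ug≡-Wg) = ⊥-elim (Xg≢𝟘 (±-zero U≡±X g (trans Ug≡-Wg (neg-zero⁺ W g Wg))))

  -- The value at 𝟘 is junk.
  orient : Sign → SignVec n → SignVec n
  orient ⊖ X = negᵥ X
  orient 𝟘 X = X
  orient ⊕ X = X

  orient-injective : ∀ s {X Y} → orient s X ≡ orient s Y → X ≡ Y
  orient-injective ⊖ = negᵥ-injective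
  orient-injective 𝟘 eq = eq
  orient-injective ⊕ eq = eq

  orient-vertex : ∀ s {X g f} → s ≢ 𝟘 → IsCocircuit X → lookup X g ≡ s →
                  Vertex O g f (orient s X)
  orient-vertex ⊖ {X} {g} _ Xc Xg = C1 Xc , trans (lookup-neg X g) (cong -_ Xg)
  orient-vertex 𝟘 s≢𝟘 _ _ = ⊥-elim (s≢𝟘 refl)
  orient-vertex ⊕ _ Xc Xg = Xc , Xg

  orient-edge : ∀ s {X Y g f} → Edge O f g X Y → Edge O g f (orient s Y) (orient s X)
  orient-edge ⊖ {X} {Y} (conf , cm) =
    Conformal-neg Y X (Conformal-sym X Y conf) , Comodular-neg (Comodular-sym cm)
  orient-edge 𝟘 {X} {Y} (conf , cm) = Conformal-sym X Y conf , Comodular-sym cm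
  orient-edge ⊕ {X} {Y} (conf , cm) = Conformal-sym X Y conf , Comodular-sym cm

  -- Swapping the endpoints and scaling them by `s` turns the elimination `W` of `g` between
  -- `negᵥ X` and `Y` into its multiple by `- s`: `W` itself for ⊖, `negᵥ W` for ⊕. This factor
  -- cancels the one in `elimination-swap`.
  reversed-elimination : ∀ s {X Y Z f g} → s ≢ 𝟘 → Comodular O X Y →
    lookup X f ≡ ⊕ → lookup X g ≡ s → lookup Y g ≡ s →
    IsElimination O f (negᵥ X) Y Z →
    ∃ λ W → IsElimination O g (negᵥ (orient s Y)) (orient s X) W × lookup W f ≡ lookup Z g
  reversed-elimination s {X} {Y} {Z} {f} {g} s≢𝟘 cm@(Xc , Yc , X≢Y , _) Xf Xg Yg Zel
    with C3 g (C1 Xc) Yc (X≢Y ∘ negᵥ-injective)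
           ( trans (lookup-neg X g) (cong -_ (trans Xg (sym Yg)))
           , λ -Xg≡𝟘 → s≢𝟘 (trans (sym Xg) (neg-zero⁻ X g -Xg≡𝟘)))
  ... | W , Wel = oriented s s≢𝟘 (elimination-swap cm s≢𝟘 Xf Xg Zel Wel)
    where
    oriented : ∀ s → s ≢ 𝟘 → lookup W f ≡ - (s · lookup Z g) →
      ∃ λ W → IsElimination O g (negᵥ (orient s Y)) (orient s X) W × lookup W f ≡ lookup Z g
    oriented ⊖ _ Wf =
      W , subst (λ V → IsElimination O g V (negᵥ X) W) (sym (negᵥ-involutive Y)) (IsElimination-sym (negᵥ X) Y Wel) ,
      trans Wf (-‿involutive _)
    oriented 𝟘 s≢𝟘 _ = ⊥-elim (s≢𝟘 refl)
    oriented ⊕ _ Wf =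
      negᵥ W , subst (λ V → IsElimination O g (negᵥ Y) V (negᵥ W)) (negᵥ-involutive X)
                 (IsElimination-sym (negᵥ (negᵥ X)) (negᵥ Y)
                   (IsElimination-neg (negᵥ X) Y Wel)) ,
      trans (lookup-neg W f) (trans (cong -_ Wf) (-‿involutive _))

  -- Conformality excludes a drop from ⊕ to ⊖. In a drop by one level, the elimination `Z` has entry
  -- 𝟘 or ⊖ at `g`. The direction of the step forbids ⊖, and 𝟘 would make `Z` equal up to sign to
  -- the endpoint vanishing at `g`, although `Z` vanishes at `f` and that endpoint does not.
  step-monotone : ∀ {f g X Y} → Vertex O f g X → Vertex O f g Y → Step O f g X Y →
                  level (lookup X g) ≤ level (lookup Y g)
  step-monotone {f} {g} {X} {Y} (Xc , Xf) (Yc , Yf) ((conf , cm) , dir) = by-sign _ _ refl refl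
    where
    -- Z is not ± V because it vanishes at f.
    no-common-zero : ∀ {V Z} → IsCocircuit V → lookup V f ≡ ⊕ → Spanned X Y V →
      IsElimination O f (negᵥ X) Y Z → ¬ (lookup X g ≡ 𝟘 × lookup Y g ≡ 𝟘) →
      lookup V g ≡ 𝟘 → lookup Z g ≢ 𝟘
    no-common-zero Vc Vf VXY Zel@(Zc , Zf , _) g∉ Vg Zg = ≡⇒≢𝟘 (λ ()) Vf
      (±-zero (line-unique cm Zc Vc (IsElimination⇒Spanned X Y Zel) VXY g g∉ Zg Vg) f Zf)

    elimination : Forward O f g X Y ⊎ Undirected O f g X Y →
      ∃ λ Z → IsElimination O f (negᵥ X) Y Z × lookup Z g ≢ ⊖
    elimination (inj₁ (Z , Zel , Zg)) = Z , Zel , λ Zg≡⊖ → ⊕≢⊖ (trans (sym Zg) Zg≡⊖)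
      where
      ⊕≢⊖ : ⊕ ≢ ⊖
      ⊕≢⊖ ()
    elimination (inj₂ (Z , Zel , Zg)) = Z , Zel , λ Zg≡⊖ → 𝟘≢⊖ (trans (sym Zg) Zg≡⊖)
      where
      𝟘≢⊖ : 𝟘 ≢ ⊖
      𝟘≢⊖ ()

    by-sign : ∀ s t → lookup X g ≡ s → lookup Y g ≡ t → level s ≤ level t
    by-sign ⊖ _ _ _ = z≤n
    by-sign 𝟘 𝟘 _ _ = s≤s z≤n
    by-sign 𝟘 ⊕ _ _ = s≤s z≤n
    by-sign ⊕ ⊕ _ _ = ℕₚ.≤-refl
    by-sign ⊕ ⊖ Xg Yg = ⊥-elim (conf g (trans Xg (cong -_ (sym Yg)) , ≡⇒≢𝟘 (λ ()) Xg))
    by-sign 𝟘 ⊖ Xg Yg with elimination dir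
    ... | Z , Zel@(_ , _ , signs) , Zg≢⊖ = ⊥-elim (Zg≢𝟘
          ([ (λ Zg → Zg)
           , [ (λ Zg≡-Xg → trans Zg≡-Xg (neg-zero⁺ X g Xg))
             , (λ Zg≡Yg → ⊥-elim (Zg≢⊖ (trans Zg≡Yg Yg))) ]′ ]′ (signs g)))
      where
      Zg≢𝟘 : lookup Z g ≢ 𝟘
      Zg≢𝟘 = no-common-zero Xc Xf (λ _ Xa _ → Xa) Zel (≡⇒≢𝟘 (λ ()) Yg ∘ proj₂) Xg
    by-sign ⊕ 𝟘 Xg Yg with elimination dir
    ... | Z , Zel@(_ , _ , signs) , Zg≢⊖ = ⊥-elim (Zg≢𝟘
          ([ (λ Zg → Zg)
           , [ (λ Zg≡-Xg → ⊥-elim (Zg≢⊖ (trans Zg≡-Xg (trans (lookup-neg X g) (cong -_ Xg)))))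
             , (λ Zg≡Yg → trans Zg≡Yg Yg) ]′ ]′ (signs g)))
      where
      Zg≢𝟘 : lookup Z g ≢ 𝟘
      Zg≢𝟘 = no-common-zero Yc Yf (λ _ _ Ya → Ya) Zel (≡⇒≢𝟘 (λ ()) Xg ∘ proj₁) Yg

-- Cyclic successor

next-fromℕ : ∀ k → next (fromℕ k) ≡ zero
next-fromℕ k with k ℕ.≟ toℕ (fromℕ k)
... | yes _ = refl
... | no k≢ = ⊥-elim (k≢ (sym (toℕ-fromℕ k)))

next-inject₁ : ∀ {k} (i : Fin k) → next (inject₁ i) ≡ suc i
next-inject₁ {k} i with k ℕ.≟ toℕ (inject₁ i)
... | yes k≡ = ⊥-elim (toℕ-inject₁-≢ i k≡)
... | no k≢ = cong suc (lower₁-inject₁′ i k≢)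

opposite-fromℕ : ∀ k → opposite (fromℕ k) ≡ zero
-- `opposite zero` computes to `fromℕ k`, so involutivity at `zero` is already the claim.
opposite-fromℕ k = opposite-involutive zero

opposite-inject₁ : ∀ {k} (i : Fin k) → opposite (inject₁ i) ≡ suc (opposite i)
opposite-inject₁ i = trans
  (cong (opposite ∘ inject₁) (sym (opposite-involutive i)))
  (opposite-involutive (suc (opposite i)))

-- Conjugation by `opposite` inverts the cyclic successor. The proof splits the indices into the
-- last one and the `inject₁ i`.
next-opposite-next : ∀ {k} (i : Fin (suc k)) → next (opposite (next i)) ≡ opposite i
next-opposite-next {k} = >-weakInduction _ last (λ i _ → inner i)
  where
  last : next (opposite (next (fromℕ k))) ≡ opposite (fromℕ k)
  last = trans (cong (next ∘ opposite) (next-fromℕ k))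
           (trans (next-fromℕ k) (sym (opposite-fromℕ k)))
  inner : ∀ i → next (opposite (next (inject₁ i))) ≡ opposite (inject₁ i)
  inner i = trans (cong (next ∘ opposite) (next-inject₁ i))
              (trans (next-inject₁ (opposite i)) (sym (opposite-inject₁ i)))

-- Going up to the last index and wrapping around bounds `φ i` by `φ zero`; going up from `zero`
-- gives the converse bound.
cyclically-monotone⇒constant : ∀ {k} (φ : Fin (suc k) → ℕ) →
  (∀ i → φ i ≤ φ (next i)) → ∀ i → φ i ≡ φ zero
cyclically-monotone⇒constant {k} φ mono i = ℕₚ.≤-antisym
  (ℕₚ.≤-trans (>-weakInduction (λ i → φ i ≤ φ (fromℕ k)) ℕₚ.≤-refl
                (λ i → ℕₚ.≤-trans (mono₁ i)) i)
              (subst (λ j → φ (fromℕ k) ≤ φ j) (next-fromℕ k) (mono (fromℕ k))))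
  (<-weakInduction (λ i → φ zero ≤ φ i) ℕₚ.≤-refl
    (λ i φ₀≤ → ℕₚ.≤-trans φ₀≤ (mono₁ i)) i)
  where
  mono₁ : ∀ i → φ (inject₁ i) ≤ φ (suc i)
  mono₁ i = subst (λ j → φ (inject₁ i) ≤ φ j) (next-inject₁ i) (mono (inject₁ i))

-- Reversal of a directed cycle

module _ {n : ℕ} (O : OrientedMatroid n) (g f : Fin n) where

  reverse-cycle : DirectedCycle O f g → DirectedCycle O g f
  reverse-cycle (k , v , v-injective , vertex , step , i₀ , forward₀@(_ , Zel , Zg)) =
    -- The forward edge from `i₀` to `next i₀` is traversed backwards, so in the new indexing it
    -- starts at `opposite (next i₀)`.
    k , v′ , v′-injective , vertex′ , step′ , opposite (next i₀) , forward′
    where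
    s : Sign
    s = lookup (v zero) g

    g-entry : ∀ i → lookup (v i) g ≡ s
    g-entry i = level-injective (cyclically-monotone⇒constant (λ i → level (lookup (v i) g))
      (λ i → step-monotone O (vertex i) (vertex (next i)) (step i)) i)

    s≢𝟘 : s ≢ 𝟘
    s≢𝟘 s≡𝟘 = ≡⇒≢𝟘 (λ ()) Zg
      (IsElimination⇒Spanned O (v i₀) (v (next i₀)) Zel g (trans (g-entry i₀) s≡𝟘) (trans (g-entry (next i₀)) s≡𝟘))

    v′ : Fin (suc k) → SignVec n
    v′ i = orient O s (v (opposite i))

    v′-injective : ∀ i j → v′ i ≡ v′ j → i ≡ j
    v′-injective i j eq = trans (sym (opposite-involutive i)) (trans
      (cong opposite (v-injective _ _ (orient-injective O s eq))) (opposite-involutive j))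

    vertex′ : ∀ i → Vertex O g f (v′ i)
    vertex′ i = orient-vertex O s {f = f} s≢𝟘 (proj₁ (vertex (opposite i))) (g-entry (opposite i))

    reversed : ∀ j {Z} → IsElimination O f (negᵥ (v j)) (v (next j)) Z →
      ∃ λ W → IsElimination O g (negᵥ (orient O s (v (next j)))) (orient O s (v j)) W
              × lookup W f ≡ lookup Z g
    reversed j = reversed-elimination O s s≢𝟘 (proj₂ (proj₁ (step j)))
      (proj₂ (vertex j)) (g-entry j) (g-entry (next j))

    reversed-forward : ∀ j → Forward O f g (v j) (v (next j)) →
      Forward O g f (orient O s (v (next j))) (orient O s (v j))
    reversed-forward j (Z , Zel , Zg) with reversed j Zel
    ... | W , Wel , Wf≡Zg = W , Wel , trans Wf≡Zg Zg

    reversed-undirected : ∀ j → Undirected O f g (v j) (v (next j)) →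
      Undirected O g f (orient O s (v (next j))) (orient O s (v j))
    reversed-undirected j (Z , Zel , Zg) with reversed j Zel
    ... | W , Wel , Wf≡Zg = W , Wel , trans Wf≡Zg Zg

    reversed-step : ∀ j → Step O g f (orient O s (v (next j))) (orient O s (v j))
    reversed-step j = orient-edge O s {g = g} {f = f} (proj₁ (step j)) ,
      Sum.map (reversed-forward j) (reversed-undirected j) (proj₂ (step j))

    step′ : ∀ i → Step O g f (v′ i) (v′ (next i))
    -- The new edge leaving `i` reverses the old edge that leaves `opposite (next i)` and ends at
    -- `opposite i`.
    step′ i = subst (λ j → Step O g f (orient O s (v j)) (v′ (next i)))
      (next-opposite-next i) (reversed-step (opposite (next i)))

    forward′ : Forward O g f (v′ (opposite (next i₀))) (v′ (next (opposite (next i₀))))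
    forward′ = subst₂ (λ a b → Forward O g f (orient O s (v a)) (orient O s (v b)))
      (sym (opposite-involutive (next i₀)))
      (sym (trans (cong opposite (next-opposite-next i₀)) (opposite-involutive i₀)))
      (reversed-forward i₀ forward₀)

theorem2p14 : ∀ {n : ℕ} (O : OrientedMatroid n) (g f : Fin n) →
    IsProgram O g f → IsEuclidean O g f →
    IsProgram O f g → IsEuclidean O f g
theorem2p14 O g f _ euclidean _ = euclidean ∘ reverse-cycle O g f
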